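{- For every integer $n\ge 1$, the following identity of polynomials in $x$ over $\mathbb{C}$ holds: $$B_n^{(n)}(x+1)=\sum_{l=0}^{n}S_1(n,l)\,\frac{1}{l+1}\left((x+1)^{l+1}-x^{l+1}\right).$$
   Context: For an integer $r\ge 0$, the Bernoulli polynomials of order $r$ are defined by $\left(\frac{t}{e^t-1}\right)^r e^{xt}=\sum_{n=0}^{\infty}B_n^{(r)}(x)\frac{t^n}{n!}$. $S_1(n,l)$ denotes the (signed) Stirling numbers of the first kind, defined by $(x)_n=\sum_{l=0}^{n}S_1(n,l)x^l$, where $(x)_n=x(x-1)\cdots(x-n+1)$. -}

module Defs where

open import Algebra.Bundles using (RawRing; CommutativeRing)
import Algebra.Definitions.RawSemiring as RawSemiringDefs
import Algebra.Properties.Ring as RingProperties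
import Algebra.Properties.Semiring.Mult as Mult
import Algebra.Properties.Semiring.Sum as Sum
open import Data.Fin.Base using (Fin; zero; suc; toℕ)
open import Data.Integer.Base as ℤ using (ℤ; -[1+_])
open import Data.List.Base as List using (List; []; _∷_)
open import Data.Nat.Base as ℕ using (ℕ; zero; suc; _∸_; _!)
open import Data.Vec.Functional as Vector using (Vector)
open import Level using (Level; _⊔_)
open import Relation.Binary.PropositionalEquality as ≡ using (_≡_)
import Relation.Binary.Reasoning.Setoid as SetoidReasoning

-- R[x]: coefficient lists, constant term first.  Trailing zeros are allowed, so
-- equality compares coefficients rather than lists.
module Polynomial {c ℓ : Level} (R : RawRing c ℓ) where
  open RawRing R

  Poly : Set c
  Poly = List Carrier

  coeff : Poly → ℕ → Carrier
  coeff []      _       = 0#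
  coeff (a ∷ p) zero    = a
  coeff (a ∷ p) (suc n) = coeff p n

  infix 4 _≈ₚ_
  _≈ₚ_ : Poly → Poly → Set ℓ
  p ≈ₚ q = ∀ n → coeff p n ≈ coeff q n

  infixl 6 _+ₚ_ _-ₚ_
  infixl 7 _*ₚ_
  infixr 7 _·_

  _+ₚ_ : Poly → Poly → Poly
  []      +ₚ q       = q
  p       +ₚ []      = p
  (a ∷ p) +ₚ (b ∷ q) = (a + b) ∷ (p +ₚ q)

  _·_ : Carrier → Poly → Poly
  a · p = List.map (a *_) p

  _*ₚ_ : Poly → Poly → Poly
  []      *ₚ q = []
  (a ∷ p) *ₚ q = a · q +ₚ (0# ∷ p *ₚ q)

  -ₚ_ : Poly → Poly
  -ₚ p = List.map -_ p

  _-ₚ_ : Poly → Poly → Poly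
  p -ₚ q = p +ₚ (-ₚ q)

  C : Carrier → Poly
  C a = a ∷ []

  1ₚ X : Poly
  1ₚ = C 1#
  X  = 0# ∷ 1# ∷ []

  -- p(q)
  infixl 8 _⟨_⟩
  _⟨_⟩ : Poly → Poly → Poly
  []      ⟨ q ⟩ = []
  (a ∷ p) ⟨ q ⟩ = C a +ₚ q *ₚ (p ⟨ q ⟩)

  polyRawRing : RawRing c ℓ
  polyRawRing = record
    { Carrier = Poly
    ; _≈_     = _≈ₚ_
    ; _+_     = _+ₚ_
    ; _*_     = _*ₚ_
    ; -_      = -ₚ_
    ; 0#      = []
    ; 1#      = 1ₚ
    }

  open RawSemiringDefs (RawRing.rawSemiring polyRawRing) public
    using () renaming (_^_ to _^ₚ_; sum to sumₚ)

-- R[[t]]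
module PowerSeries {c ℓ : Level} (R : RawRing c ℓ) where
  open RawRing R
  open RawSemiringDefs rawSemiring using (sum)

  Series : Set c
  Series = ℕ → Carrier

  infix 4 _≈ₛ_
  _≈ₛ_ : Series → Series → Set ℓ
  f ≈ₛ g = ∀ n → f n ≈ g n

  infixl 6 _+ₛ_ _-ₛ_
  infixl 7 _*ₛ_

  _+ₛ_ : Series → Series → Series
  (f +ₛ g) n = f n + g n

  _*ₛ_ : Series → Series → Series
  (f *ₛ g) n = sum (λ (k : Fin (suc n)) → f (toℕ k) * g (n ∸ toℕ k))

  -ₛ_ : Series → Series
  (-ₛ f) n = - f n

  _-ₛ_ : Series → Series → Series
  f -ₛ g = f +ₛ (-ₛ g)

  0ₛ 1ₛ t : Series
  0ₛ _ = 0#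

  1ₛ zero    = 1#
  1ₛ (suc _) = 0#

  t zero    = 0#
  t (suc n) = 1ₛ n

  seriesRawRing : RawRing c ℓ
  seriesRawRing = record
    { Carrier = Series
    ; _≈_     = _≈ₛ_
    ; _+_     = _+ₛ_
    ; _*_     = _*ₛ_
    ; -_      = -ₛ_
    ; 0#      = 0ₛ
    ; 1#      = 1ₛ
    }

  open RawSemiringDefs (RawRing.rawSemiring seriesRawRing) public
    using () renaming (_^_ to _^ₛ_)

  -- The first n + 1 coefficients of 1/u, highest degree first, provided u has
  -- constant term 1: solve (u · g)ₙ₊₁ = 0 for gₙ₊₁.
  reciprocalCoeffs : Series → (n : ℕ) → Vector Carrier (suc n)
  reciprocalCoeffs u zero    = λ _ → 1#
  reciprocalCoeffs u (suc n) =
    (- sum (λ k → u (suc (toℕ k)) * reciprocalCoeffs u n k))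
      Vector.∷ reciprocalCoeffs u n

  reciprocal : Series → Series
  reciprocal u n = reciprocalCoeffs u n zero

module ℤ[x] = Polynomial ℤ.+-*-rawRing

-- (x)ₙ = x (x - 1) ⋯ (x - n + 1)
fallingFactorial : ℕ → ℤ[x].Poly
fallingFactorial zero    = ℤ[x].1ₚ
fallingFactorial (suc n) = fallingFactorial n ℤ[x].*ₚ (ℤ[x].X ℤ[x].-ₚ ℤ[x].C (ℤ.+ n))

-- Signed: the coefficient of xˡ in (x)ₙ.
S₁ : ℕ → ℕ → ℤ
S₁ n l = ℤ[x].coeff (fallingFactorial n) l

-- A ℚ-algebra structure on R: every positive integer is invertible.
record IsℚAlgebra {c ℓ : Level} (R : CommutativeRing c ℓ) : Set (c ⊔ ℓ) where
  open CommutativeRing R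
  open RawSemiringDefs (RawRing.rawSemiring rawRing) using (_×_)
  field
    1/suc         : ℕ → Carrier
    1/suc-inverse : ∀ n → 1/suc n * (suc n × 1#) ≈ 1#

module Bernoulli {c ℓ : Level} (R : CommutativeRing c ℓ) (isℚAlgebra : IsℚAlgebra R) where
  open CommutativeRing R
  open IsℚAlgebra isℚAlgebra public
  open RawSemiringDefs (RawRing.rawSemiring rawRing) using (_×_; sum)

  module R[x]      = Polynomial rawRing
  module R[[t]]    = PowerSeries rawRing
  module R[x][[t]] = PowerSeries R[x].polyRawRing

  fromℤ : ℤ → Carrier
  fromℤ (ℤ.+ n)  = n × 1#
  fromℤ -[1+ n ] = - (suc n × 1#)

  1/_! : ℕ → Carrier
  1/ zero  ! = 1#
  1/ suc n ! = 1/suc n * 1/ n !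

  eᵗ : R[[t]].Series
  eᵗ n = 1/ n !

  eˣᵗ : R[x][[t]].Series
  eˣᵗ n = 1/ n ! R[x].· (R[x].X R[x].^ₚ n)

  [eᵗ-1]/t : R[[t]].Series
  [eᵗ-1]/t n = eᵗ (suc n)

  t/[eᵗ-1] : R[[t]].Series
  t/[eᵗ-1] = R[[t]].reciprocal [eᵗ-1]/t

  -- (t/(eᵗ-1))ʳ eˣᵗ
  generatingFunction : ℕ → R[x][[t]].Series
  generatingFunction r = (λ n → R[x].C ((t/[eᵗ-1] R[[t]].^ₛ r) n)) R[x][[t]].*ₛ eˣᵗ

  -- B r n is Bₙ⁽ʳ⁾(x).
  B : ℕ → ℕ → R[x].Poly
  B r n = ((n !) × 1#) R[x].· generatingFunction r n

  open SetoidReasoning setoid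
  open Sum semiring using (sum-cong-≋)
  open RingProperties ring using (-0#≈0#)

  1/!-inverse : ∀ n → 1/ n ! * ((n !) × 1#) ≈ 1#
  1/!-inverse zero    = trans (*-identityˡ _) (+-identityʳ 1#)
  1/!-inverse (suc n) = begin
    (1/suc n * 1/ n !) * ((suc n ℕ.* (n !)) × 1#)
      ≈⟨ *-congˡ (Mult.×1-homo-* semiring (suc n) (n !)) ⟩
    (1/suc n * 1/ n !) * ((suc n × 1#) * ((n !) × 1#))
      ≈⟨ *-assoc _ _ _ ⟩
    1/suc n * (1/ n ! * ((suc n × 1#) * ((n !) × 1#)))
      ≈⟨ *-congˡ (trans (*-congˡ (*-comm _ _)) (sym (*-assoc _ _ _))) ⟩
    1/suc n * ((1/ n ! * ((n !) × 1#)) * (suc n × 1#))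
      ≈⟨ *-congˡ (trans (*-congʳ (1/!-inverse n)) (*-identityˡ _)) ⟩
    1/suc n * (suc n × 1#)
      ≈⟨ 1/suc-inverse n ⟩
    1# ∎

  coeff-· : ∀ a p n → R[x].coeff (a R[x].· p) n ≈ a * R[x].coeff p n
  coeff-· a []      n       = sym (zeroʳ a)
  coeff-· a (b ∷ p) zero    = refl
  coeff-· a (b ∷ p) (suc n) = coeff-· a p n

  reciprocalCoeffs-reciprocal : ∀ u n (k : Fin (suc n)) →
    R[[t]].reciprocalCoeffs u n k ≡ R[[t]].reciprocal u (n ∸ toℕ k)
  reciprocalCoeffs-reciprocal u n       zero    = ≡.refl
  reciprocalCoeffs-reciprocal u (suc n) (suc k) = reciprocalCoeffs-reciprocal u n k

  reciprocal-inverse : ∀ u → u 0 ≈ 1# → u R[[t]].*ₛ R[[t]].reciprocal u R[[t]].≈ₛ R[[t]].1ₛ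
  reciprocal-inverse u u₀≈1 zero    = begin
    u 0 * 1# + 0# ≈⟨ +-identityʳ _ ⟩
    u 0 * 1#      ≈⟨ *-identityʳ _ ⟩
    u 0           ≈⟨ u₀≈1 ⟩
    1#            ∎
  reciprocal-inverse u u₀≈1 (suc n) = begin
    u 0 * (- s) + s′ ≈⟨ +-cong (trans (*-congʳ u₀≈1) (*-identityˡ _)) (sum-cong-≋ s′≈s) ⟩
    - s + s          ≈⟨ -‿inverseˡ s ⟩
    0#               ∎
    where
    s s′ : Carrier
    s  = sum (λ (k : Fin (suc n)) → u (suc (toℕ k)) * R[[t]].reciprocalCoeffs u n k)
    s′ = sum (λ (k : Fin (suc n)) → u (suc (toℕ k)) * R[[t]].reciprocal u (n ∸ toℕ k))
    s′≈s : ∀ (k : Fin (suc n)) → u (suc (toℕ k)) * R[[t]].reciprocal u (n ∸ toℕ k)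
                               ≈ u (suc (toℕ k)) * R[[t]].reciprocalCoeffs u n k
    s′≈s k = *-congˡ (reflexive (≡.sym (reciprocalCoeffs-reciprocal u n k)))

  t/[eᵗ-1]-correct : (eᵗ R[[t]].-ₛ R[[t]].1ₛ) R[[t]].*ₛ t/[eᵗ-1] R[[t]].≈ₛ R[[t]].t
  t/[eᵗ-1]-correct zero    = begin
    (1# + - 1#) * t/[eᵗ-1] 0 + 0# ≈⟨ +-identityʳ _ ⟩
    (1# + - 1#) * t/[eᵗ-1] 0      ≈⟨ *-congʳ (-‿inverseʳ 1#) ⟩
    0# * t/[eᵗ-1] 0               ≈⟨ zeroˡ _ ⟩
    0#                            ∎
  t/[eᵗ-1]-correct (suc n) = begin
    (1# + - 1#) * t/[eᵗ-1] (suc n)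
      + sum (λ (k : Fin (suc n)) → (eᵗ (suc (toℕ k)) + - 0#) * t/[eᵗ-1] (n ∸ toℕ k))
      ≈⟨ +-cong (trans (*-congʳ (-‿inverseʳ 1#)) (zeroˡ _)) (sum-cong-≋ terms) ⟩
    0# + ([eᵗ-1]/t R[[t]].*ₛ t/[eᵗ-1]) n
      ≈⟨ +-identityˡ _ ⟩
    ([eᵗ-1]/t R[[t]].*ₛ t/[eᵗ-1]) n
      ≈⟨ reciprocal-inverse [eᵗ-1]/t [eᵗ-1]/t₀≈1 n ⟩
    R[[t]].1ₛ n ∎
    where
    terms : ∀ (k : Fin (suc n)) → (eᵗ (suc (toℕ k)) + - 0#) * t/[eᵗ-1] (n ∸ toℕ k)
                                ≈ [eᵗ-1]/t (toℕ k) * t/[eᵗ-1] (n ∸ toℕ k)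
    terms k = *-congʳ (trans (+-congˡ -0#≈0#) (+-identityʳ _))
    [eᵗ-1]/t₀≈1 : 1/suc 0 * 1# ≈ 1#
    [eᵗ-1]/t₀≈1 = trans (*-congˡ (sym (+-identityʳ 1#))) (1/suc-inverse 0)

  B-generatingFunction : ∀ r → generatingFunction r R[x][[t]].≈ₛ λ n → 1/ n ! R[x].· B r n
  B-generatingFunction r n k = sym (begin
    R[x].coeff (1/ n ! R[x].· B r n) k                 ≈⟨ coeff-· _ (B r n) k ⟩
    1/ n ! * R[x].coeff (B r n) k                      ≈⟨ *-congˡ (coeff-· _ (generatingFunction r n) k) ⟩
    1/ n ! * (((n !) × 1#) * R[x].coeff (generatingFunction r n) k) ≈⟨ *-assoc _ _ _ ⟨
    1/ n ! * ((n !) × 1#) * R[x].coeff (generatingFunction r n) k   ≈⟨ *-congʳ (1/!-inverse n) ⟩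
    1# * R[x].coeff (generatingFunction r n) k         ≈⟨ *-identityˡ _ ⟩
    R[x].coeff (generatingFunction r n) k              ∎)

-- Write e = eᵗ, E = (e - 1)/t, f = t/(e - 1) and θ = t d/dt.  From θf = f - f²e and fe = f + t, the
-- series hₙ = fⁿ⁺¹e satisfy θhₙ = (n+1)hₙ - (n+1)hₙ₊₁ - n t hₙ.  On coefficients this is the recurrence of
-- the Stirling numbers, so l! S₁(n,l) = n! [tⁿ⁻ˡ] hₙ, that is, (x)ₙ = Bₙ⁽ⁿ⁺¹⁾(x+1).  The right-hand side of
-- the theorem integrates (u)ₙ over [x, x+1], which multiplies the generating function by E; since
-- Ehₙ = fⁿe, both sides have xʲ-coefficient n!/j! [tⁿ⁻ʲ] fⁿe.

module Submission where

open import Defs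
open import Algebra.Bundles using (CommutativeRing; RawRing)
open import Algebra.Consequences.Setoid using (comm∧idˡ⇒id; comm∧distrʳ⇒distr)
import Algebra.Construct.Pointwise as Pointwise
import Algebra.Definitions.RawSemiring as RawSemiringDefs
import Algebra.Properties.AbelianGroup as AbelianGroupProperties
import Algebra.Properties.CommutativeSemigroup as CommutativeSemigroupProperties
import Algebra.Properties.Group as GroupProperties
import Algebra.Properties.Ring as RingProperties
import Algebra.Properties.Semiring.Mult as Mult
import Algebra.Properties.Semiring.Sum as Sum
import Algebra.Solver.Ring.NaturalCoefficients.Default as RingSolver
open import Algebra.Structures using (IsCommutativeRing)
open import Data.Fin.Base as Fin using (Fin; toℕ)
open import Data.Fin.Properties using (toℕ≤pred[n])
open import Data.Integer.Base as ℤ using (-[1+_]; _⊖_)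
import Data.Integer.Properties as ℤ
open import Data.Integer.Solver using (module +-*-Solver)
open import Data.Nat.Base as ℕ using (ℕ; zero; suc; _≤_; z≤n; s≤s; _∸_; _!)
open import Data.List.Base as List using ([]; _∷_)
open import Data.Vec.Functional using (Vector)
open import Relation.Binary.PropositionalEquality as ≡ using (_≡_)
import Relation.Binary.Reasoning.Setoid as SetoidReasoning

-- The ring of series over `R` serves twice: for series in t and, through `coeff`, for coefficient
-- sequences of polynomials in x, with `t` then standing for x. The identity is checked one power of
-- x at a time: the x^j-coefficient of e^((x+1)t) is the one-variable series t^j e / j!, so all the
-- real work takes place in `R[[t]]`. Two obstacles shape the statements. The coefficient [tⁿ⁻ˡ] of
-- a series g appears as `(t ^ₛ l *ₛ g) n`: this is zero for l > n, whereas truncated subtraction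
-- would return the constant term of g, and the induction for the Stirling numbers does reach l =
-- n+1. Also, the ring solver works over commutative semirings, so the differential equations and
-- the Stirling recurrence are written with their negative terms moved to the other side and
-- cancelled at the end.

module PowerSeriesRing {c ℓ} (R : CommutativeRing c ℓ) where
  open CommutativeRing R hiding (zero)
  open PowerSeries rawRing
  open SetoidReasoning setoid
  open CommutativeSemigroupProperties +-commutativeSemigroup using (x∙yz≈y∙xz; interchange)

  -- Ring laws of the Cauchy product.

  tail : Series → Series
  tail f n = f (suc n)

  infixr 7 _•_
  _•_ : Carrier → Series → Series
  (a • f) n = a * f n

  *ₛ-cong : ∀ {f f′ g g′} → f ≈ₛ f′ → g ≈ₛ g′ → f *ₛ g ≈ₛ f′ *ₛ g′
  *ₛ-cong f≈ g≈ zero    = +-congʳ (*-cong (f≈ 0) (g≈ 0))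
  -- A product at `suc n` is definitionally `f 0 * g (suc n) + (tail f *ₛ g) n`; the inductions
  -- below peel off the first factor in this way.
  *ₛ-cong f≈ g≈ (suc n) = +-cong (*-cong (f≈ 0) (g≈ (suc n))) (*ₛ-cong (λ k → f≈ (suc k)) g≈ n)

  *ₛ-congˡ : ∀ f {g h} → g ≈ₛ h → f *ₛ g ≈ₛ f *ₛ h
  *ₛ-congˡ f = *ₛ-cong {f} (λ _ → refl)

  *ₛ-congʳ : ∀ h {f g} → f ≈ₛ g → f *ₛ h ≈ₛ g *ₛ h
  *ₛ-congʳ h f≈g = *ₛ-cong f≈g (λ _ → refl)

  -- Peels off the last summand instead of the first. Commuting the factors reverses the sum, so
  -- `*ₛ-comm` needs both ends.
  *ₛ-sucʳ : ∀ f g n → (f *ₛ g) (suc n) ≈ f (suc n) * g 0 + (f *ₛ tail g) n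
  *ₛ-sucʳ f g zero    = begin
    f 0 * g 1 + (f 1 * g 0 + 0#)  ≈⟨ x∙yz≈y∙xz _ _ _ ⟩
    f 1 * g 0 + (f 0 * g 1 + 0#)  ∎
  *ₛ-sucʳ f g (suc n) = begin
    f 0 * g (suc (suc n)) + (tail f *ₛ g) (suc n)
      ≈⟨ +-congˡ (*ₛ-sucʳ (tail f) g n) ⟩
    f 0 * g (suc (suc n)) + (f (suc (suc n)) * g 0 + (tail f *ₛ tail g) n)
      ≈⟨ x∙yz≈y∙xz _ _ _ ⟩
    f (suc (suc n)) * g 0 + (f *ₛ tail g) (suc n) ∎

  *ₛ-comm : ∀ f g → f *ₛ g ≈ₛ g *ₛ f
  *ₛ-comm f g zero    = +-congʳ (*-comm _ _)
  *ₛ-comm f g (suc n) = begin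
    f 0 * g (suc n) + (tail f *ₛ g) n  ≈⟨ +-cong (*-comm _ _) (*ₛ-comm (tail f) g n) ⟩
    g (suc n) * f 0 + (g *ₛ tail f) n  ≈⟨ *ₛ-sucʳ g f n ⟨
    (g *ₛ f) (suc n)                   ∎

  *ₛ-distribʳ-+ₛ : ∀ h f g → (f +ₛ g) *ₛ h ≈ₛ f *ₛ h +ₛ g *ₛ h
  *ₛ-distribʳ-+ₛ h f g zero    = begin
    (f 0 + g 0) * h 0 + 0#             ≈⟨ +-cong (distribʳ _ _ _) (sym (+-identityʳ 0#)) ⟩
    f 0 * h 0 + g 0 * h 0 + (0# + 0#)  ≈⟨ interchange _ _ _ _ ⟩
    (f *ₛ h +ₛ g *ₛ h) 0               ∎
  *ₛ-distribʳ-+ₛ h f g (suc n) = begin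
    (f 0 + g 0) * h (suc n) + ((tail f +ₛ tail g) *ₛ h) n
      ≈⟨ +-cong (distribʳ _ _ _) (*ₛ-distribʳ-+ₛ h (tail f) (tail g) n) ⟩
    f 0 * h (suc n) + g 0 * h (suc n) + ((tail f *ₛ h) n + (tail g *ₛ h) n)
      ≈⟨ interchange _ _ _ _ ⟩
    (f *ₛ h +ₛ g *ₛ h) (suc n) ∎

  •-assoc-*ₛ : ∀ a f g → (a • f) *ₛ g ≈ₛ a • (f *ₛ g)
  •-assoc-*ₛ a f g zero    = begin
    a * f 0 * g 0 + 0#    ≈⟨ +-identityʳ _ ⟩
    a * f 0 * g 0         ≈⟨ *-assoc _ _ _ ⟩
    a * (f 0 * g 0)       ≈⟨ *-congˡ (+-identityʳ _) ⟨
    a * (f 0 * g 0 + 0#)  ∎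
  •-assoc-*ₛ a f g (suc n) = begin
    a * f 0 * g (suc n) + ((a • tail f) *ₛ g) n  ≈⟨ +-cong (*-assoc _ _ _) (•-assoc-*ₛ a (tail f) g n) ⟩
    a * (f 0 * g (suc n)) + a * (tail f *ₛ g) n  ≈⟨ distribˡ _ _ _ ⟨
    a * (f *ₛ g) (suc n)                         ∎

  *ₛ-assoc : ∀ f g h → (f *ₛ g) *ₛ h ≈ₛ f *ₛ (g *ₛ h)
  *ₛ-assoc f g h zero    = begin
    (f 0 * g 0 + 0#) * h 0 + 0#  ≈⟨ +-congʳ (*-congʳ (+-identityʳ _)) ⟩
    f 0 * g 0 * h 0 + 0#         ≈⟨ +-congʳ (*-assoc _ _ _) ⟩
    f 0 * (g 0 * h 0) + 0#       ≈⟨ +-congʳ (*-congˡ (+-identityʳ _)) ⟨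
    f 0 * (g 0 * h 0 + 0#) + 0#  ∎
  *ₛ-assoc f g h (suc n) = begin
    (f 0 * g 0 + 0#) * h (suc n) + ((f 0 • tail g +ₛ tail f *ₛ g) *ₛ h) n
      ≈⟨ +-cong (trans (*-congʳ (+-identityʳ _)) (*-assoc _ _ _)) (*ₛ-distribʳ-+ₛ h (f 0 • tail g) (tail f *ₛ g) n) ⟩
    f 0 * (g 0 * h (suc n)) + (((f 0 • tail g) *ₛ h) n + ((tail f *ₛ g) *ₛ h) n)
      ≈⟨ +-assoc _ _ _ ⟨
    f 0 * (g 0 * h (suc n)) + ((f 0 • tail g) *ₛ h) n + ((tail f *ₛ g) *ₛ h) n
      ≈⟨ +-cong (+-congˡ (•-assoc-*ₛ (f 0) (tail g) h n)) (*ₛ-assoc (tail f) g h n) ⟩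
    f 0 * (g 0 * h (suc n)) + f 0 * (tail g *ₛ h) n + (tail f *ₛ (g *ₛ h)) n
      ≈⟨ +-congʳ (distribˡ _ _ _) ⟨
    (f *ₛ (g *ₛ h)) (suc n) ∎

  -- The Euler derivation, powers of t, and the commutative ring of series.

  open RawSemiringDefs (RawRing.rawSemiring rawRing) using (_×_)
  open RawSemiringDefs (RawRing.rawSemiring seriesRawRing) using () renaming (_×_ to _×ₛ_)

  -- The derivation t d/dt.
  θ : Series → Series
  θ f n = (n × 1#) * f n

  θ-cong : ∀ {f g} → f ≈ₛ g → θ f ≈ₛ θ g
  θ-cong f≈g n = *-congˡ (f≈g n)

  -- Induction on the degree: passing to the tail lowers degrees by one, so `tail (θ f)` is
  -- `tail f +ₛ θ (tail f)`, and the extra `tail f` accounts for the 1 in `suc n`.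
  θ-*ₛ : ∀ f g → θ (f *ₛ g) ≈ₛ θ f *ₛ g +ₛ f *ₛ θ g
  θ-*ₛ f g zero    = begin
    0# * (f *ₛ g) 0                                ≈⟨ zeroˡ _ ⟩
    0#                                             ≈⟨ zeroʳ _ ⟨
    f 0 * 0#                                       ≈⟨ *-congˡ (zeroˡ _) ⟨
    f 0 * (0# * g 0)                               ≈⟨ +-identityʳ _ ⟨
    f 0 * (0# * g 0) + 0#                          ≈⟨ +-identityˡ _ ⟨
    0# + (f *ₛ θ g) 0                              ≈⟨ +-congʳ (trans (+-identityʳ _) (trans (*-congʳ (zeroˡ _)) (zeroˡ _))) ⟨
    (θ f *ₛ g) 0 + (f *ₛ θ g) 0                    ∎
  θ-*ₛ f g (suc n) = begin
    (1# + N) * (f 0 * g (suc n) + (tail f *ₛ g) n)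
      ≈⟨ solve 4 (λ x y z w → (con 1 :+ x) :* (y :* z :+ w) := y :* ((con 1 :+ x) :* z) :+ (w :+ x :* w))
           refl N (f 0) (g (suc n)) ((tail f *ₛ g) n) ⟩
    f 0 * θ g (suc n) + ((tail f *ₛ g) n + N * (tail f *ₛ g) n)
      ≈⟨ +-congˡ (+-congˡ (θ-*ₛ (tail f) g n)) ⟩
    f 0 * θ g (suc n) + ((tail f *ₛ g) n + ((θ (tail f) *ₛ g) n + (tail f *ₛ θ g) n))
      ≈⟨ solve 4 (λ x y z w → x :+ (y :+ (z :+ w)) := (y :+ z) :+ (x :+ w)) refl _ _ _ _ ⟩
    (tail f *ₛ g) n + (θ (tail f) *ₛ g) n + (f *ₛ θ g) (suc n)
      ≈⟨ +-congʳ (*ₛ-distribʳ-+ₛ g (tail f) (θ (tail f)) n) ⟨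
    ((tail f +ₛ θ (tail f)) *ₛ g) n + (f *ₛ θ g) (suc n)
      ≈⟨ +-congʳ (*ₛ-congʳ g tail-θ n) ⟨
    (tail (θ f) *ₛ g) n + (f *ₛ θ g) (suc n)
      ≈⟨ +-congʳ (trans (+-congʳ (trans (*-congʳ (zeroˡ _)) (zeroˡ _))) (+-identityˡ _)) ⟨
    (θ f *ₛ g) (suc n) + (f *ₛ θ g) (suc n) ∎
    where
    open RingSolver commutativeSemiring
    N : Carrier
    N = n × 1#
    tail-θ : tail (θ f) ≈ₛ tail f +ₛ θ (tail f)
    tail-θ k = trans (distribʳ _ _ _) (+-congʳ (*-identityˡ _))

  0ₛ-*ₛ : ∀ f → 0ₛ *ₛ f ≈ₛ 0ₛ
  0ₛ-*ₛ f zero    = trans (+-identityʳ _) (zeroˡ _)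
  0ₛ-*ₛ f (suc n) = trans (+-cong (zeroˡ _) (0ₛ-*ₛ f n)) (+-identityˡ 0#)

  1ₛ-*ₛ : ∀ f → 1ₛ *ₛ f ≈ₛ f
  1ₛ-*ₛ f zero    = trans (+-identityʳ _) (*-identityˡ _)
  1ₛ-*ₛ f (suc n) = trans (+-cong (*-identityˡ _) (0ₛ-*ₛ f n)) (+-identityʳ _)

  t-*ₛ-suc : ∀ f n → (t *ₛ f) (suc n) ≈ f n
  t-*ₛ-suc f n = trans (+-cong (zeroˡ _) (1ₛ-*ₛ f n)) (+-identityˡ _)

  t-*ₛ-zero : ∀ f → (t *ₛ f) 0 ≈ 0#
  t-*ₛ-zero f = trans (+-identityʳ _) (zeroˡ _)

  t^*ₛ-∸ : ∀ f {m n} → m ≤ n → (t ^ₛ m *ₛ f) n ≈ f (n ∸ m)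
  t^*ₛ-∸ f {n = n} z≤n                 = 1ₛ-*ₛ f n
  t^*ₛ-∸ f (s≤s {m} {n} m≤n) = begin
    (t *ₛ t ^ₛ m *ₛ f) (suc n)    ≈⟨ *ₛ-assoc t (t ^ₛ m) f (suc n) ⟩
    (t *ₛ (t ^ₛ m *ₛ f)) (suc n)  ≈⟨ t-*ₛ-suc (t ^ₛ m *ₛ f) n ⟩
    (t ^ₛ m *ₛ f) n               ≈⟨ t^*ₛ-∸ f m≤n ⟩
    f (n ∸ m)                     ∎

  -- `(t ^ₛ m) n` is a Kronecker delta, so `f` may be read at either index. With `eᵗ` for `f` this
  -- exchanges the roles of x and t in x^m / m!.
  t^-transpose : ∀ (f : Series) m n → f m * (t ^ₛ m) n ≈ f n * (t ^ₛ n) m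
  t^-transpose f zero    zero    = refl
  t^-transpose f zero    (suc n) = trans (zeroʳ _) (sym (trans (*-congˡ (t-*ₛ-zero (t ^ₛ n))) (zeroʳ _)))
  t^-transpose f (suc m) zero    = sym (t^-transpose f zero (suc m))
  t^-transpose f (suc m) (suc n) = begin
    f (suc m) * (t ^ₛ suc m) (suc n)  ≈⟨ *-congˡ (t-*ₛ-suc (t ^ₛ m) n) ⟩
    f (suc m) * (t ^ₛ m) n            ≈⟨ t^-transpose (tail f) m n ⟩
    f (suc n) * (t ^ₛ n) m            ≈⟨ *-congˡ (t-*ₛ-suc (t ^ₛ n) m) ⟨
    f (suc n) * (t ^ₛ suc n) (suc m)  ∎

  -- In an abstract ring an integer scalar can only be a multiple of the unit; this translates it
  -- back to scaling of coefficients.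
  ×1ₛ-*ₛ : ∀ m f → (m ×ₛ 1ₛ) *ₛ f ≈ₛ (m × 1#) • f
  ×1ₛ-*ₛ zero    f n = trans (0ₛ-*ₛ f n) (sym (zeroˡ _))
  ×1ₛ-*ₛ (suc m) f n = begin
    ((1ₛ +ₛ m ×ₛ 1ₛ) *ₛ f) n            ≈⟨ *ₛ-distribʳ-+ₛ f 1ₛ (m ×ₛ 1ₛ) n ⟩
    (1ₛ *ₛ f) n + ((m ×ₛ 1ₛ) *ₛ f) n    ≈⟨ +-cong (1ₛ-*ₛ f n) (×1ₛ-*ₛ m f n) ⟩
    f n + (m × 1#) * f n                ≈⟨ +-congʳ (*-identityˡ _) ⟨
    1# * f n + (m × 1#) * f n           ≈⟨ distribʳ _ _ _ ⟨
    (1# + m × 1#) * f n                 ∎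

  θt≈t : θ t ≈ₛ t
  θt≈t zero          = zeroˡ 0#
  θt≈t (suc zero)    = trans (*-identityʳ _) (+-identityʳ 1#)
  θt≈t (suc (suc n)) = zeroʳ _

  seriesIsCommutativeRing : IsCommutativeRing _≈ₛ_ _+ₛ_ _*ₛ_ -ₛ_ 0ₛ 1ₛ
  seriesIsCommutativeRing = record
    { isRing = record
      { +-isAbelianGroup = Pointwise.isAbelianGroup ℕ +-isAbelianGroup
      ; *-cong     = *ₛ-cong
      ; *-assoc    = *ₛ-assoc
      ; *-identity = comm∧idˡ⇒id S *ₛ-comm 1ₛ-*ₛ
      ; distrib    = comm∧distrʳ⇒distr S (λ f≈ g≈ n → +-cong (f≈ n) (g≈ n)) *ₛ-comm *ₛ-distribʳ-+ₛ
      }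
    ; *-comm = *ₛ-comm
    }
    where S = record { isEquivalence = Pointwise.isEquivalence ℕ isEquivalence }

  seriesCommutativeRing : CommutativeRing c ℓ
  seriesCommutativeRing = record { isCommutativeRing = seriesIsCommutativeRing }

-- The differential equation of `h n` in an abstract ring with a derivation.

module Derivation {c ℓ} (S : CommutativeRing c ℓ) where
  open CommutativeRing S hiding (zero)
  open SetoidReasoning setoid
  open RawSemiringDefs (RawRing.rawSemiring rawRing) using (_×_; _^_)
  open RingSolver commutativeSemiring
  open GroupProperties +-group using (identityʳ-unique)

  module _
    (θ : Carrier → Carrier)
    (θ-cong : ∀ {x y} → x ≈ y → θ x ≈ θ y)
    (θ-* : ∀ x y → θ (x * y) ≈ θ x * y + x * θ y)
    where

    θ-1# : θ 1# ≈ 0#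
    θ-1# = identityʳ-unique (θ 1#) (θ 1#) (begin
      θ 1# + θ 1#            ≈⟨ +-cong (*-identityʳ _) (*-identityˡ _) ⟨
      θ 1# * 1# + 1# * θ 1#  ≈⟨ θ-* 1# 1# ⟨
      θ (1# * 1#)            ≈⟨ θ-cong (*-identityˡ 1#) ⟩
      θ 1#                   ∎)

    module _ (t : Carrier) (θt≈t : θ t ≈ t) where

      θ-t^ : ∀ l → θ (t ^ l) ≈ (l × 1#) * t ^ l
      θ-t^ zero    = trans θ-1# (sym (zeroˡ _))
      θ-t^ (suc l) = begin
        θ (t * t ^ l)                       ≈⟨ θ-* t (t ^ l) ⟩
        θ t * t ^ l + t * θ (t ^ l)         ≈⟨ +-cong (*-congʳ θt≈t) (*-congˡ (θ-t^ l)) ⟩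
        t * t ^ l + t * ((l × 1#) * t ^ l)
          ≈⟨ solve 3 (λ x y z → x :* y :+ x :* (z :* y) := (con 1 :+ z) :* (x :* y)) refl t (t ^ l) (l × 1#) ⟩
        (1# + l × 1#) * (t * t ^ l)         ∎

      θ-t^* : ∀ l x → θ (t ^ l * x) ≈ (l × 1#) * (t ^ l * x) + t ^ l * θ x
      θ-t^* l x = begin
        θ (t ^ l * x)                         ≈⟨ θ-* (t ^ l) x ⟩
        θ (t ^ l) * x + t ^ l * θ x           ≈⟨ +-congʳ (trans (*-congʳ (θ-t^ l)) (*-assoc _ _ _)) ⟩
        (l × 1#) * (t ^ l * x) + t ^ l * θ x  ∎

      -- Abstractly e = eᵗ, E = (eᵗ - 1)/t and f = t/(eᵗ - 1).
      module Exponential (e E f : Carrier) (θe≈te : θ e ≈ t * e) (e≈1+tE : e ≈ 1# + t * E)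
        (θE+E≈e : θ E + E ≈ e) (fE≈1 : f * E ≈ 1#) where

        θ-t^*e : ∀ l → θ (t ^ l * e) ≈ (l × 1#) * (t ^ l * e) + t * (t ^ l * e)
        θ-t^*e l = begin
          θ (t ^ l * e)                           ≈⟨ θ-t^* l e ⟩
          (l × 1#) * (t ^ l * e) + t ^ l * θ e    ≈⟨ +-congˡ (*-congˡ θe≈te) ⟩
          (l × 1#) * (t ^ l * e) + t ^ l * (t * e)
            ≈⟨ +-congˡ (solve 3 (λ x y z → x :* (y :* z) := y :* (x :* z)) refl (t ^ l) t e) ⟩
          (l × 1#) * (t ^ l * e) + t * (t ^ l * e) ∎

        fe≈f+t : f * e ≈ f + t
        fe≈f+t = begin
          f * e             ≈⟨ *-congˡ e≈1+tE ⟩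
          f * (1# + t * E)  ≈⟨ solve 3 (λ x y z → x :* (con 1 :+ y :* z) := x :+ y :* (x :* z)) refl f t E ⟩
          f + t * (f * E)   ≈⟨ +-congˡ (trans (*-congˡ fE≈1) (*-identityʳ t)) ⟩
          f + t             ∎

        -- Differentiate fE = 1 and multiply by f, using θE = e - E and fe = f + t. In logarithmic
        -- form: θf / f = 1 - f - t.
        θf+f[f+t]≈f : θ f + f * (f + t) ≈ f
        θf+f[f+t]≈f = begin
          θ f + f * (f + t)
            ≈⟨ +-cong (trans (*-congˡ fE≈1) (*-identityʳ _)) (*-congˡ (trans (*-congˡ θE+E≈e) fe≈f+t)) ⟨
          θ f * (f * E) + f * (f * (θ E + E))
            ≈⟨ solve 4 (λ x x′ y y′ → x′ :* (x :* y) :+ x :* (x :* (y′ :+ y)) := x :* ((x′ :* y :+ x :* y′) :+ x :* y))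
                 refl f (θ f) E (θ E) ⟩
          f * ((θ f * E + f * θ E) + f * E)
            ≈⟨ *-congˡ (+-congʳ (θ-* f E)) ⟨
          f * (θ (f * E) + f * E)
            ≈⟨ *-congˡ (+-cong (trans (θ-cong fE≈1) θ-1#) fE≈1) ⟩
          f * (0# + 1#)
            ≈⟨ trans (*-congˡ (+-identityˡ 1#)) (*-identityʳ f) ⟩
          f ∎

        h : ℕ → Carrier
        h n = f ^ suc n * e

        hE≈fⁿe : ∀ n → h n * E ≈ f ^ n * e
        hE≈fⁿe n = begin
          (f * f ^ n) * e * E
            ≈⟨ solve 4 (λ x y z w → x :* y :* z :* w := x :* w :* (y :* z)) refl f (f ^ n) e E ⟩
          f * E * (f ^ n * e)  ≈⟨ trans (*-congʳ fE≈1) (*-identityˡ _) ⟩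
          f ^ n * e            ∎

        -- Logarithmically, each of the n+1 factors `f` contributes 1 - f - t and the factor `e`
        -- contributes t, which lowers the coefficient of `t * h n` from n+1 to n. Formally this is
        -- induction along `h (suc n) ≈ f * h n`.
        θ-h : ∀ n → θ (h n) + (suc n × 1#) * h (suc n) + (n × 1#) * (t * h n) ≈ (suc n × 1#) * h n
        θ-h zero    = begin
          θ (f * 1# * e) + (1# + 0#) * (f * (f * 1#) * e) + 0# * (t * (f * 1# * e))
            ≈⟨ +-congʳ (+-congʳ (trans (θ-cong (*-congʳ (*-identityʳ f))) (trans (θ-* f e) (+-congˡ (*-congˡ θe≈te))))) ⟩
          θ f * e + f * (t * e) + (1# + 0#) * (f * (f * 1#) * e) + 0# * (t * (f * 1# * e))
            ≈⟨ solve 4 (λ f f′ t e →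
                  f′ :* e :+ f :* (t :* e) :+ (con 1 :+ con 0) :* (f :* (f :* con 1) :* e) :+ con 0 :* (t :* (f :* con 1 :* e))
                  := (f′ :+ f :* (f :+ t)) :* e)
                 refl f (θ f) t e ⟩
          (θ f + f * (f + t)) * e
            ≈⟨ *-congʳ θf+f[f+t]≈f ⟩
          f * e
            ≈⟨ solve 2 (λ f e → f :* e := (con 1 :+ con 0) :* (f :* con 1 :* e)) refl f e ⟩
          (1# + 0#) * (f * 1# * e) ∎
        θ-h (suc n) = begin
          θ (h (suc n)) + (1# + (1# + N)) * h (suc (suc n)) + (1# + N) * (t * h (suc n))
            ≈⟨ +-congʳ (+-congʳ (trans (θ-cong h-suc) (θ-* f (h n)))) ⟩
          θ f * h n + f * θ (h n) + (1# + (1# + N)) * h (suc (suc n)) + (1# + N) * (t * h (suc n))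
            ≈⟨ solve 7 (λ f f′ t e k hₙ′ fⁿ →
                  f′ :* (f :* fⁿ :* e) :+ f :* hₙ′ :+ (con 1 :+ (con 1 :+ k)) :* (f :* (f :* (f :* fⁿ)) :* e)
                    :+ (con 1 :+ k) :* (t :* (f :* (f :* fⁿ) :* e))
                  := (f′ :+ f :* (f :+ t)) :* (f :* fⁿ :* e)
                    :+ f :* (hₙ′ :+ (con 1 :+ k) :* (f :* (f :* fⁿ) :* e) :+ k :* (t :* (f :* fⁿ :* e))))
                 refl f (θ f) t e N (θ (h n)) (f ^ n) ⟩
          (θ f + f * (f + t)) * h n + f * (θ (h n) + (1# + N) * h (suc n) + N * (t * h n))
            ≈⟨ +-cong (*-congʳ θf+f[f+t]≈f) (*-congˡ (θ-h n)) ⟩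
          f * h n + f * ((1# + N) * h n)
            ≈⟨ solve 3 (λ f k h → f :* h :+ f :* ((con 1 :+ k) :* h) := (con 1 :+ (con 1 :+ k)) :* (f :* h)) refl f N (h n) ⟩
          (1# + (1# + N)) * (f * h n)
            ≈⟨ *-congˡ h-suc ⟨
          (1# + (1# + N)) * h (suc n) ∎
          where
          N : Carrier
          N = n × 1#
          h-suc : h (suc n) ≈ f * h n
          h-suc = *-assoc _ _ _

        θ-t^*h : ∀ l n → θ (t ^ l * h n) + (suc n × 1#) * (t ^ l * h (suc n)) + (n × 1#) * (t * (t ^ l * h n))
                       ≈ (l × 1#) * (t ^ l * h n) + (suc n × 1#) * (t ^ l * h n)
        θ-t^*h l n = begin
          θ (t ^ l * h n) + (suc n × 1#) * (t ^ l * h (suc n)) + (n × 1#) * (t * (t ^ l * h n))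
            ≈⟨ +-congʳ (+-congʳ (θ-t^* l (h n))) ⟩
          (l × 1#) * (t ^ l * h n) + t ^ l * θ (h n) + (suc n × 1#) * (t ^ l * h (suc n)) + (n × 1#) * (t * (t ^ l * h n))
            ≈⟨ solve 8 (λ a u x′ b y k t x →
                  a :* (u :* x) :+ u :* x′ :+ b :* (u :* y) :+ k :* (t :* (u :* x))
                  := a :* (u :* x) :+ u :* (x′ :+ b :* y :+ k :* (t :* x)))
                 refl (l × 1#) (t ^ l) (θ (h n)) (suc n × 1#) (h (suc n)) (n × 1#) t (h n) ⟩
          (l × 1#) * (t ^ l * h n) + t ^ l * (θ (h n) + (suc n × 1#) * h (suc n) + (n × 1#) * (t * h n))
            ≈⟨ +-congˡ (*-congˡ (θ-h n)) ⟩
          (l × 1#) * (t ^ l * h n) + t ^ l * ((suc n × 1#) * h n)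
            ≈⟨ +-congˡ (solve 3 (λ u b x → u :* (b :* x) := b :* (u :* x)) refl (t ^ l) (suc n × 1#) (h n)) ⟩
          (l × 1#) * (t ^ l * h n) + (suc n × 1#) * (t ^ l * h n) ∎

-- Polynomials in x as coefficient sequences, and substitution.

module PolynomialCoefficients {c ℓ} (R : CommutativeRing c ℓ) where
  open CommutativeRing R hiding (zero)
  open Polynomial rawRing
  open PowerSeries rawRing using (Series; _≈ₛ_; _+ₛ_; _*ₛ_; -ₛ_; 0ₛ; 1ₛ; t; _^ₛ_)

  open RawSemiringDefs (RawRing.rawSemiring rawRing) using (sum)
  open RingProperties ring using (-0#≈0#)
  open PowerSeriesRing R
  private module S = CommutativeRing seriesCommutativeRing
  open RingSolver S.commutativeSemiring using (solve; _:+_; _:*_; _:=_)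

  coeff-map : ∀ φ → φ 0# ≈ 0# → ∀ p n → coeff (List.map φ p) n ≈ φ (coeff p n)
  coeff-map φ φ0≈0 []      n       = sym φ0≈0
  coeff-map φ φ0≈0 (a ∷ p) zero    = refl
  coeff-map φ φ0≈0 (a ∷ p) (suc n) = coeff-map φ φ0≈0 p n

  coeff-· : ∀ a p → coeff (a · p) ≈ₛ a • coeff p
  coeff-· a = coeff-map (a *_) (zeroʳ a)

  coeff--ₚ : ∀ p → coeff (-ₚ p) ≈ₛ -ₛ coeff p
  coeff--ₚ = coeff-map -_ -0#≈0#

  coeff-+ₚ : ∀ p q → coeff (p +ₚ q) ≈ₛ coeff p +ₛ coeff q
  coeff-+ₚ []      q       n       = sym (+-identityˡ _)
  coeff-+ₚ (a ∷ p) []      n       = sym (+-identityʳ _)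
  coeff-+ₚ (a ∷ p) (b ∷ q) zero    = refl
  coeff-+ₚ (a ∷ p) (b ∷ q) (suc n) = coeff-+ₚ p q n

  coeff-*ₚ : ∀ p q → coeff (p *ₚ q) ≈ₛ coeff p *ₛ coeff q
  coeff-*ₚ []      q n       = sym (0ₛ-*ₛ (coeff q) n)
  coeff-*ₚ (a ∷ p) q zero    = trans (coeff-+ₚ (a · q) _ 0) (+-congʳ (coeff-· a q 0))
  coeff-*ₚ (a ∷ p) q (suc n) = trans (coeff-+ₚ (a · q) _ (suc n)) (+-cong (coeff-· a q (suc n)) (coeff-*ₚ p q n))

  coeff-1ₚ : coeff 1ₚ ≈ₛ 1ₛ
  coeff-1ₚ zero    = refl
  coeff-1ₚ (suc n) = refl

  -- From here on, `t` may also stand for x: a coefficient sequence is indexed by powers of x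
  -- although it lives in the same ring as the series in t.
  coeff-X : coeff X ≈ₛ t
  coeff-X zero          = refl
  coeff-X (suc zero)    = refl
  coeff-X (suc (suc n)) = refl

  ^ₛ-cong : ∀ {f g} → f ≈ₛ g → ∀ m → f ^ₛ m ≈ₛ g ^ₛ m
  ^ₛ-cong f≈g zero    = S.refl
  ^ₛ-cong f≈g (suc m) = *ₛ-cong f≈g (^ₛ-cong f≈g m)

  coeff-^ₚ : ∀ p m → coeff (p ^ₚ m) ≈ₛ coeff p ^ₛ m
  coeff-^ₚ p zero    = coeff-1ₚ
  coeff-^ₚ p (suc m) = S.trans (coeff-*ₚ p (p ^ₚ m)) (*ₛ-congˡ (coeff p) (coeff-^ₚ p m))

  coeff-sumₚ : ∀ {m} (p : Vector Poly m) n → coeff (sumₚ p) n ≈ sum (λ k → coeff (p k) n)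
  coeff-sumₚ {zero}  p n = refl
  coeff-sumₚ {suc m} p n = trans (coeff-+ₚ (p Fin.zero) _ n) (+-congˡ (coeff-sumₚ (λ k → p (Fin.suc k)) n))

  C-*ₛ : ∀ a f → coeff (C a) *ₛ f ≈ₛ a • f
  C-*ₛ a f zero    = +-identityʳ _
  C-*ₛ a f (suc n) = trans (+-congˡ (0ₛ-*ₛ f n)) (+-identityʳ _)

  C-0# : coeff (C 0#) ≈ₛ 0ₛ
  C-0# zero    = refl
  C-0# (suc n) = refl

  module Composition (q : Poly) where
    ρ : Series
    ρ = coeff q

    ⟦_⟧ : Poly → Series
    ⟦ p ⟧ = coeff (p ⟨ q ⟩)

    ⟦∷⟧ : ∀ a p → ⟦ a ∷ p ⟧ ≈ₛ coeff (C a) +ₛ ρ *ₛ ⟦ p ⟧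
    ⟦∷⟧ a p = S.trans (coeff-+ₚ (C a) (q *ₚ (p ⟨ q ⟩))) (S.+-congˡ (coeff-*ₚ q (p ⟨ q ⟩)))

    ⟦0∷⟧ : ∀ p → ⟦ 0# ∷ p ⟧ ≈ₛ ρ *ₛ ⟦ p ⟧
    ⟦0∷⟧ p = S.trans (⟦∷⟧ 0# p) (S.trans (S.+-congʳ C-0#) (S.+-identityˡ _))

    ⟦⟧-C : ∀ a → ⟦ C a ⟧ ≈ₛ coeff (C a)
    ⟦⟧-C a = S.trans (⟦∷⟧ a []) (S.trans (S.+-congˡ (S.zeroʳ ρ)) (S.+-identityʳ _))

    ⟦⟧-+ₚ : ∀ p p′ → ⟦ p +ₚ p′ ⟧ ≈ₛ ⟦ p ⟧ +ₛ ⟦ p′ ⟧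
    ⟦⟧-+ₚ []      p′       = S.sym (S.+-identityˡ _)
    ⟦⟧-+ₚ (a ∷ p) []       = S.sym (S.+-identityʳ _)
    ⟦⟧-+ₚ (a ∷ p) (b ∷ p′) = begin
      ⟦ (a + b) ∷ (p +ₚ p′) ⟧
        ≈⟨ ⟦∷⟧ (a + b) (p +ₚ p′) ⟩
      coeff (C a +ₚ C b) +ₛ ρ *ₛ ⟦ p +ₚ p′ ⟧
        ≈⟨ S.+-cong (coeff-+ₚ (C a) (C b)) (*ₛ-congˡ ρ (⟦⟧-+ₚ p p′)) ⟩
      (coeff (C a) +ₛ coeff (C b)) +ₛ ρ *ₛ (⟦ p ⟧ +ₛ ⟦ p′ ⟧)
        ≈⟨ solve 5 (λ a b r x y → (a :+ b) :+ r :* (x :+ y) := (a :+ r :* x) :+ (b :+ r :* y)) S.refl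
             (coeff (C a)) (coeff (C b)) ρ ⟦ p ⟧ ⟦ p′ ⟧ ⟩
      (coeff (C a) +ₛ ρ *ₛ ⟦ p ⟧) +ₛ (coeff (C b) +ₛ ρ *ₛ ⟦ p′ ⟧)
        ≈⟨ S.+-cong (⟦∷⟧ a p) (⟦∷⟧ b p′) ⟨
      ⟦ a ∷ p ⟧ +ₛ ⟦ b ∷ p′ ⟧ ∎
      where open SetoidReasoning S.setoid

    -- The scalar is written as the constant series `coeff (C a)` and not with `_•_`, so that it is
    -- a ring element to which the solver applies.
    ⟦⟧-· : ∀ a p → ⟦ a · p ⟧ ≈ₛ coeff (C a) *ₛ ⟦ p ⟧
    ⟦⟧-· a []      = S.sym (S.zeroʳ (coeff (C a)))
    ⟦⟧-· a (b ∷ p) = begin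
      ⟦ (a * b) ∷ (a · p) ⟧
        ≈⟨ ⟦∷⟧ (a * b) (a · p) ⟩
      coeff (a · C b) +ₛ ρ *ₛ ⟦ a · p ⟧
        ≈⟨ S.+-cong (S.trans (coeff-· a (C b)) (S.sym (C-*ₛ a (coeff (C b))))) (*ₛ-congˡ ρ (⟦⟧-· a p)) ⟩
      coeff (C a) *ₛ coeff (C b) +ₛ ρ *ₛ (coeff (C a) *ₛ ⟦ p ⟧)
        ≈⟨ solve 4 (λ a b r x → a :* b :+ r :* (a :* x) := a :* (b :+ r :* x)) S.refl
             (coeff (C a)) (coeff (C b)) ρ ⟦ p ⟧ ⟩
      coeff (C a) *ₛ (coeff (C b) +ₛ ρ *ₛ ⟦ p ⟧)
        ≈⟨ *ₛ-congˡ (coeff (C a)) (⟦∷⟧ b p) ⟨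
      coeff (C a) *ₛ ⟦ b ∷ p ⟧ ∎
      where open SetoidReasoning S.setoid

    ⟦⟧-*ₚ : ∀ p p′ → ⟦ p *ₚ p′ ⟧ ≈ₛ ⟦ p ⟧ *ₛ ⟦ p′ ⟧
    ⟦⟧-*ₚ []      p′ = S.sym (S.zeroˡ ⟦ p′ ⟧)
    ⟦⟧-*ₚ (a ∷ p) p′ = begin
      ⟦ a · p′ +ₚ (0# ∷ p *ₚ p′) ⟧
        ≈⟨ ⟦⟧-+ₚ (a · p′) _ ⟩
      ⟦ a · p′ ⟧ +ₛ ⟦ 0# ∷ p *ₚ p′ ⟧
        ≈⟨ S.+-cong (⟦⟧-· a p′) (S.trans (⟦0∷⟧ (p *ₚ p′)) (*ₛ-congˡ ρ (⟦⟧-*ₚ p p′))) ⟩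
      coeff (C a) *ₛ ⟦ p′ ⟧ +ₛ ρ *ₛ (⟦ p ⟧ *ₛ ⟦ p′ ⟧)
        ≈⟨ solve 4 (λ a r x y → a :* y :+ r :* (x :* y) := (a :+ r :* x) :* y) S.refl
             (coeff (C a)) ρ ⟦ p ⟧ ⟦ p′ ⟧ ⟩
      (coeff (C a) +ₛ ρ *ₛ ⟦ p ⟧) *ₛ ⟦ p′ ⟧
        ≈⟨ *ₛ-congʳ ⟦ p′ ⟧ (⟦∷⟧ a p) ⟨
      ⟦ a ∷ p ⟧ *ₛ ⟦ p′ ⟧ ∎
      where open SetoidReasoning S.setoid

    ⟦⟧-X : ⟦ X ⟧ ≈ₛ ρ
    ⟦⟧-X = S.trans (⟦0∷⟧ 1ₚ) (S.trans (*ₛ-congˡ ρ (S.trans (⟦⟧-C 1#) coeff-1ₚ)) (S.*-identityʳ ρ))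

    ⟦⟧-X^ : ∀ m → ⟦ X ^ₚ m ⟧ ≈ₛ ρ ^ₛ m
    ⟦⟧-X^ zero    = S.trans (⟦⟧-C 1#) coeff-1ₚ
    ⟦⟧-X^ (suc m) = S.trans (⟦⟧-*ₚ X (X ^ₚ m)) (*ₛ-cong ⟦⟧-X (⟦⟧-X^ m))

    ⟦⟧-sumₚ : ∀ {m} (p : Vector Poly m) n → ⟦ sumₚ p ⟧ n ≈ sum (λ k → ⟦ p k ⟧ n)
    ⟦⟧-sumₚ {zero}  p n = refl
    ⟦⟧-sumₚ {suc m} p n = trans (⟦⟧-+ₚ (p Fin.zero) _ n) (+-congˡ (⟦⟧-sumₚ (λ k → p (Fin.suc k)) n))

-- The recurrence of the Stirling numbers of the first kind.

module _ where
  private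
    module ℤCoeff = PolynomialCoefficients ℤ.+-*-commutativeRing
    module ℤ[[t]] = PowerSeriesRing ℤ.+-*-commutativeRing
    open +-*-Solver
    open ≡.≡-Reasoning

    linearFactor : ℕ → ℤ[x].Poly
    linearFactor n = ℤ[x].X ℤ[x].-ₚ ℤ[x].C (ℤ.+ n)

    -- The linear factor is brought to the left because products unfold along their first factor:
    -- its constant term and its tail `C 1` leave just the two terms of the recurrence.
    coeff-fallingFactorial-suc : ∀ n l → S₁ (suc n) l ≡
      PowerSeries._*ₛ_ ℤ.+-*-rawRing (ℤ[x].coeff (linearFactor n)) (S₁ n) l
    coeff-fallingFactorial-suc n l = ≡.trans
      (ℤCoeff.coeff-*ₚ (fallingFactorial n) (linearFactor n) l)
      (ℤ[[t]].*ₛ-comm (S₁ n) (ℤ[x].coeff (linearFactor n)) l)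

  -- The term with -n is moved to the left, so that carrying the recurrence along `fromℤ` takes only
  -- additivity and multiplication by a natural number.
  S₁-suc-zero : ∀ n → S₁ (suc n) 0 ℤ.+ ℤ.+ n ℤ.* S₁ n 0 ≡ ℤ.0ℤ
  S₁-suc-zero n = ≡.trans (≡.cong (λ i → i ℤ.+ ℤ.+ n ℤ.* S₁ n 0) (coeff-fallingFactorial-suc n 0))
    (solve 2 (λ n x → (con ℤ.0ℤ :+ :- n) :* x :+ con ℤ.0ℤ :+ n :* x := con ℤ.0ℤ) ≡.refl (ℤ.+ n) (S₁ n 0))

  S₁-suc-suc : ∀ n l → S₁ (suc n) (suc l) ℤ.+ ℤ.+ n ℤ.* S₁ n (suc l) ≡ S₁ n l
  S₁-suc-suc n l = begin
    S₁ (suc n) (suc l) ℤ.+ ℤ.+ n ℤ.* S₁ n (suc l)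
      ≡⟨ ≡.cong (λ i → i ℤ.+ ℤ.+ n ℤ.* S₁ n (suc l)) (≡.trans (coeff-fallingFactorial-suc n (suc l)) (≡.cong (λ i → (ℤ.0ℤ ℤ.+ ℤ.- (ℤ.+ n)) ℤ.* S₁ n (suc l) ℤ.+ i) (ℤCoeff.C-*ₛ ℤ.1ℤ (S₁ n) l))) ⟩
    (ℤ.0ℤ ℤ.+ ℤ.- (ℤ.+ n)) ℤ.* S₁ n (suc l) ℤ.+ ℤ.1ℤ ℤ.* S₁ n l ℤ.+ ℤ.+ n ℤ.* S₁ n (suc l)
      ≡⟨ solve 3 (λ n x y → (con ℤ.0ℤ :+ :- n) :* x :+ con ℤ.1ℤ :* y :+ n :* x := y) ≡.refl
           (ℤ.+ n) (S₁ n (suc l)) (S₁ n l) ⟩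
    S₁ n l ∎

-- The exponential series over a ℚ-algebra.

module _ {c ℓ} (R : CommutativeRing c ℓ) (isℚAlgebra : IsℚAlgebra R) where
  open CommutativeRing R hiding (zero)
  open Bernoulli R isℚAlgebra hiding (coeff-·)
  open R[x]
  open R[[t]] using (_≈ₛ_; _+ₛ_; _*ₛ_; 1ₛ; t; _^ₛ_)
  open PowerSeriesRing R
  open PolynomialCoefficients R
  open RawSemiringDefs (RawRing.rawSemiring rawRing) using (_×_; sum)
  open Mult semiring using (×1-homo-*; ×-homo-+)
  open Sum semiring using (sum-cong-≋; *-distribˡ-sum)
  open RingProperties ring using (-‿distribʳ-*; -‿+-comm; +-cancelʳ)
  open AbelianGroupProperties +-abelianGroup using (xyx⁻¹≈y)
  open RingSolver commutativeSemiring using (solve; con; _:+_; _:*_; _:=_)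
  open SetoidReasoning setoid
  private module S = CommutativeRing seriesCommutativeRing

  suc-1/! : ∀ n → (suc n × 1#) * 1/ suc n ! ≈ 1/ n !
  suc-1/! n = begin
    (suc n × 1#) * (1/suc n * 1/ n !)  ≈⟨ *-assoc _ _ _ ⟨
    (suc n × 1#) * 1/suc n * 1/ n !    ≈⟨ *-congʳ (trans (*-comm _ _) (1/suc-inverse n)) ⟩
    1# * 1/ n !                        ≈⟨ *-identityˡ _ ⟩
    1/ n !                             ∎

  θeᵗ : θ eᵗ ≈ₛ t *ₛ eᵗ
  θeᵗ zero    = trans (zeroˡ _) (sym (t-*ₛ-zero eᵗ))
  θeᵗ (suc n) = trans (suc-1/! n) (sym (t-*ₛ-suc eᵗ n))

  eᵗ-expand : eᵗ ≈ₛ 1ₛ +ₛ t *ₛ [eᵗ-1]/t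
  eᵗ-expand zero    = sym (trans (+-congˡ (t-*ₛ-zero [eᵗ-1]/t)) (+-identityʳ 1#))
  eᵗ-expand (suc n) = sym (trans (+-identityˡ _) (t-*ₛ-suc [eᵗ-1]/t n))

  -- This is θ(tE) = te with one factor t cancelled; on coefficients it reads (n+1)/(n+1)! = 1/n!.
  θ[eᵗ-1]/t : θ [eᵗ-1]/t +ₛ [eᵗ-1]/t ≈ₛ eᵗ
  θ[eᵗ-1]/t n = begin
    (n × 1#) * 1/ suc n ! + 1/ suc n !  ≈⟨ solve 2 (λ x y → x :* y :+ y := (con 1 :+ x) :* y) refl _ _ ⟩
    (suc n × 1#) * 1/ suc n !           ≈⟨ suc-1/! n ⟩
    1/ n !                              ∎

  t/[eᵗ-1]-inverse : t/[eᵗ-1] *ₛ [eᵗ-1]/t ≈ₛ 1ₛ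
  t/[eᵗ-1]-inverse = S.trans (*ₛ-comm t/[eᵗ-1] [eᵗ-1]/t)
    (reciprocal-inverse [eᵗ-1]/t (trans (*-congˡ (sym (+-identityʳ 1#))) (1/suc-inverse 0)))

  open Derivation.Exponential seriesCommutativeRing θ θ-cong θ-*ₛ t θt≈t
    eᵗ [eᵗ-1]/t t/[eᵗ-1] θeᵗ eᵗ-expand θ[eᵗ-1]/t t/[eᵗ-1]-inverse

  -- Coefficients of e^((x+1)t) and of its difference with e^(xt).

  t^-suc-*ₛ : ∀ j f n → (t ^ₛ suc j *ₛ f) (suc n) ≈ (t ^ₛ j *ₛ f) n
  t^-suc-*ₛ j f n = trans (*ₛ-assoc t (t ^ₛ j) f (suc n)) (t-*ₛ-suc (t ^ₛ j *ₛ f) n)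

  t^-suc-*ₛ-zero : ∀ j f → (t ^ₛ suc j *ₛ f) 0 ≈ 0#
  t^-suc-*ₛ-zero j f = trans (*ₛ-assoc t (t ^ₛ j) f 0) (t-*ₛ-zero (t ^ₛ j *ₛ f))

  -- The two sides are the coefficients of xʲtᵏ in e⁽ˣ⁺¹⁾ᵗ = eˣᵗ eᵗ.
  [t+1]^ : ∀ k j → 1/ k ! * ((t +ₛ 1ₛ) ^ₛ k) j ≈ 1/ j ! * (t ^ₛ j *ₛ eᵗ) k
  [t+1]^ zero    zero    = *-congˡ (sym (1ₛ-*ₛ eᵗ 0))
  [t+1]^ zero    (suc j) = trans (zeroʳ _) (sym (trans (*-congˡ (t^-suc-*ₛ-zero j eᵗ)) (zeroʳ _)))
  [t+1]^ (suc k) j       = begin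
    1/suc k * 1/ k ! * ((t +ₛ 1ₛ) *ₛ (t +ₛ 1ₛ) ^ₛ k) j
      ≈⟨ trans (*-congˡ (trans (*ₛ-distribʳ-+ₛ D t 1ₛ j) (+-congˡ (1ₛ-*ₛ D j)))) (*-assoc _ _ _) ⟩
    1/suc k * (1/ k ! * ((t *ₛ D) j + D j))
      ≈⟨ *-congˡ (trans (distribˡ _ _ _) (+-cong (shifted j) ([t+1]^ k j))) ⟩
    1/suc k * ((j × 1#) * (1/ j ! * (t ^ₛ j *ₛ eᵗ) (suc k)) + 1/ j ! * (t ^ₛ j *ₛ eᵗ) k)
      ≈⟨ solve 5 (λ a b c x y → a :* (b :* (c :* x) :+ c :* y) := a :* (c :* (b :* x :+ y))) refl _ _ _ _ _ ⟩
    1/suc k * (1/ j ! * ((j × 1#) * (t ^ₛ j *ₛ eᵗ) (suc k) + (t ^ₛ j *ₛ eᵗ) k))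
      ≈⟨ *-congˡ (*-congˡ (+-cong (×1ₛ-*ₛ j (t ^ₛ j *ₛ eᵗ) (suc k)) (t-*ₛ-suc (t ^ₛ j *ₛ eᵗ) k))) ⟨
    1/suc k * (1/ j ! * (((j S× 1ₛ) *ₛ (t ^ₛ j *ₛ eᵗ)) (suc k) + (t *ₛ (t ^ₛ j *ₛ eᵗ)) (suc k)))
      -- In degree k+1 the derivation acts as the factor k+1, which then cancels `1/suc k`.
      ≈⟨ *-congˡ (*-congˡ (θ-t^*e j (suc k))) ⟨
    1/suc k * (1/ j ! * ((suc k × 1#) * (t ^ₛ j *ₛ eᵗ) (suc k)))
      ≈⟨ solve 4 (λ a b c x → a :* (b :* (c :* x)) := a :* c :* (b :* x)) refl _ _ _ _ ⟩
    1/suc k * (suc k × 1#) * (1/ j ! * (t ^ₛ j *ₛ eᵗ) (suc k))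
      ≈⟨ trans (*-congʳ (1/suc-inverse k)) (*-identityˡ _) ⟩
    1/ j ! * (t ^ₛ j *ₛ eᵗ) (suc k) ∎
    where
    open RawSemiringDefs (RawRing.rawSemiring S.rawRing) using () renaming (_×_ to _S×_)
    D : R[[t]].Series
    D = (t +ₛ 1ₛ) ^ₛ k
    -- On the left `t` is x, and multiplying by it moves the coefficient of x^(j-1) to x^j; on the
    -- right j/j! = 1/(j-1)!. The factor `j × 1#` lets the case j = 0, which has no predecessor,
    -- hold as 0 = 0.
    shifted : ∀ j → 1/ k ! * (t *ₛ D) j ≈ (j × 1#) * (1/ j ! * (t ^ₛ j *ₛ eᵗ) (suc k))
    shifted zero    = trans (trans (*-congˡ (t-*ₛ-zero D)) (zeroʳ _)) (sym (zeroˡ _))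
    shifted (suc j) = begin
      1/ k ! * (t *ₛ D) (suc j)                            ≈⟨ *-congˡ (t-*ₛ-suc D j) ⟩
      1/ k ! * D j                                         ≈⟨ [t+1]^ k j ⟩
      1/ j ! * (t ^ₛ j *ₛ eᵗ) k
        ≈⟨ *-cong (suc-1/! j) (t^-suc-*ₛ j eᵗ k) ⟨
      (suc j × 1#) * 1/ suc j ! * (t ^ₛ suc j *ₛ eᵗ) (suc k) ≈⟨ *-assoc _ _ _ ⟩
      (suc j × 1#) * (1/ suc j ! * (t ^ₛ suc j *ₛ eᵗ) (suc k)) ∎

  -- Compares the coefficients of xʲtˡ⁺¹ in e⁽ˣ⁺¹⁾ᵗ - eˣᵗ.
  [t+1]^-t^ : ∀ l j → 1/ suc l ! * (((t +ₛ 1ₛ) ^ₛ suc l) j + - (t ^ₛ suc l) j) ≈ 1/ j ! * (t ^ₛ j *ₛ [eᵗ-1]/t) l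
  [t+1]^-t^ l j = begin
    1/ suc l ! * (((t +ₛ 1ₛ) ^ₛ suc l) j + - (t ^ₛ suc l) j)
      ≈⟨ trans (distribˡ _ _ _) (+-congˡ (sym (-‿distribʳ-* _ _))) ⟩
    1/ suc l ! * ((t +ₛ 1ₛ) ^ₛ suc l) j + - (1/ suc l ! * (t ^ₛ suc l) j)
      -- Once transposed, the subtracted power is the coefficient of t^j / j!, exactly the part that
      -- the constant term of e = 1 + tE contributes.
      ≈⟨ +-cong ([t+1]^ (suc l) j) (-‿cong (t^-transpose eᵗ (suc l) j)) ⟩
    1/ j ! * (t ^ₛ j *ₛ eᵗ) (suc l) + - (1/ j ! * (t ^ₛ j) (suc l))
      ≈⟨ +-congʳ (trans (*-congˡ (t^*eᵗ (suc l))) (distribˡ _ _ _)) ⟩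
    1/ j ! * (t ^ₛ j) (suc l) + 1/ j ! * (t *ₛ (t ^ₛ j *ₛ [eᵗ-1]/t)) (suc l) + - (1/ j ! * (t ^ₛ j) (suc l))
      ≈⟨ xyx⁻¹≈y _ _ ⟩
    1/ j ! * (t *ₛ (t ^ₛ j *ₛ [eᵗ-1]/t)) (suc l)
      ≈⟨ *-congˡ (t-*ₛ-suc (t ^ₛ j *ₛ [eᵗ-1]/t) l) ⟩
    1/ j ! * (t ^ₛ j *ₛ [eᵗ-1]/t) l ∎
    where
    t^*eᵗ : t ^ₛ j *ₛ eᵗ ≈ₛ t ^ₛ j +ₛ t *ₛ (t ^ₛ j *ₛ [eᵗ-1]/t)
    t^*eᵗ = S.trans (*ₛ-congˡ (t ^ₛ j) eᵗ-expand)
      (Series.solve 3 (λ x y z → x Series.:* (Series.con 1 Series.:+ y Series.:* z) Series.:= x Series.:+ y Series.:* (x Series.:* z))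
        S.refl (t ^ₛ j) t [eᵗ-1]/t)
      where module Series = RingSolver S.commutativeSemiring

  -- Carrying the Stirling recurrence from ℤ to `R`.

  fromℤ-⊖-+ : ∀ m n → fromℤ (m ⊖ n) + n × 1# ≈ m × 1#
  fromℤ-⊖-+ m       zero    = +-identityʳ _
  fromℤ-⊖-+ zero    (suc n) = -‿inverseˡ _
  fromℤ-⊖-+ (suc m) (suc n) = begin
    fromℤ (suc m ⊖ suc n) + (1# + n × 1#)  ≡⟨ ≡.cong (λ i → fromℤ i + (1# + n × 1#)) (ℤ.[1+m]⊖[1+n]≡m⊖n m n) ⟩
    fromℤ (m ⊖ n) + (1# + n × 1#)          ≈⟨ solve 3 (λ x y z → x :+ (y :+ z) := y :+ (x :+ z)) refl _ _ _ ⟩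
    1# + (fromℤ (m ⊖ n) + n × 1#)          ≈⟨ +-congˡ (fromℤ-⊖-+ m n) ⟩
    1# + m × 1#                            ∎

  fromℤ-⊖ : ∀ m n → fromℤ (m ⊖ n) ≈ m × 1# + - (n × 1#)
  fromℤ-⊖ m n = begin
    fromℤ (m ⊖ n)                            ≈⟨ +-identityʳ _ ⟨
    fromℤ (m ⊖ n) + 0#                       ≈⟨ +-congˡ (-‿inverseʳ (n × 1#)) ⟨
    fromℤ (m ⊖ n) + (n × 1# + - (n × 1#))    ≈⟨ +-assoc _ _ _ ⟨
    fromℤ (m ⊖ n) + n × 1# + - (n × 1#)      ≈⟨ +-congʳ (fromℤ-⊖-+ m n) ⟩
    m × 1# + - (n × 1#)                      ∎

  fromℤ-+ : ∀ i j → fromℤ (i ℤ.+ j) ≈ fromℤ i + fromℤ j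
  fromℤ-+ (ℤ.+ m)  (ℤ.+ n)  = ×-homo-+ 1# m n
  fromℤ-+ (ℤ.+ m)  -[1+ n ] = fromℤ-⊖ m (suc n)
  fromℤ-+ -[1+ m ] (ℤ.+ n)  = trans (fromℤ-⊖ n (suc m)) (+-comm _ _)
  fromℤ-+ -[1+ m ] -[1+ n ] = begin
    - (1# + (1# + (m ℕ.+ n) × 1#))   ≈⟨ -‿cong (+-congˡ (+-congˡ (×-homo-+ 1# m n))) ⟩
    - (1# + (1# + (m × 1# + n × 1#)))
      ≈⟨ -‿cong (solve 2 (λ x y → con 1 :+ (con 1 :+ (x :+ y)) := (con 1 :+ x) :+ (con 1 :+ y)) refl _ _) ⟩
    - ((1# + m × 1#) + (1# + n × 1#)) ≈⟨ -‿+-comm _ _ ⟨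
    - (1# + m × 1#) + - (1# + n × 1#) ∎

  fromℤ-+ₙ* : ∀ n i → fromℤ (ℤ.+ n ℤ.* i) ≈ (n × 1#) * fromℤ i
  fromℤ-+ₙ* zero    i = sym (zeroˡ _)
  fromℤ-+ₙ* (suc n) i = begin
    fromℤ (ℤ.+ suc n ℤ.* i)              ≡⟨ ≡.cong fromℤ (ℤ.suc-* (ℤ.+ n) i) ⟩
    fromℤ (i ℤ.+ ℤ.+ n ℤ.* i)            ≈⟨ fromℤ-+ i (ℤ.+ n ℤ.* i) ⟩
    fromℤ i + fromℤ (ℤ.+ n ℤ.* i)        ≈⟨ +-cong (sym (*-identityˡ _)) (fromℤ-+ₙ* n i) ⟩
    1# * fromℤ i + (n × 1#) * fromℤ i    ≈⟨ distribʳ _ _ _ ⟨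
    (1# + n × 1#) * fromℤ i              ∎

  fromℤ-recurrence : ∀ n i j {k} → i ℤ.+ ℤ.+ n ℤ.* j ≡ k → fromℤ i + (n × 1#) * fromℤ j ≈ fromℤ k
  fromℤ-recurrence n i j ≡.refl =
    sym (trans (fromℤ-+ i (ℤ.+ n ℤ.* j)) (+-congˡ (fromℤ-+ₙ* n j)))

  -- Stirling numbers as coefficients of `h n`.

  suc-! : ∀ n → (suc n !) × 1# ≈ (suc n × 1#) * ((n !) × 1#)
  suc-! n = ×1-homo-* (suc n) (n !)

  -- Read coefficientwise, (x)ₙ = Bₙ⁽ⁿ⁺¹⁾(x+1).
  S₁-coefficient : ∀ n l → fromℤ (S₁ n l) * ((l !) × 1#) ≈ ((n !) × 1#) * (t ^ₛ l *ₛ h n) n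
  S₁-coefficient zero zero = begin
    (1# + 0#) * (1# + 0#)
      ≈⟨ solve 0 ((con 1 :+ con 0) :* (con 1 :+ con 0)
           := (con 1 :+ con 0) :* (con 1 :* ((con 1 :* con 1 :+ con 0) :* con 1 :+ con 0) :+ con 0)) refl ⟩
    (1# + 0#) * (1# * ((1# * 1# + 0#) * 1# + 0#) + 0#) ∎
  S₁-coefficient zero (suc l) =
    trans (zeroˡ _) (sym (trans (*-congˡ (t^-suc-*ₛ-zero l (h 0))) (zeroʳ _)))
  -- Adding `N` times the induction hypothesis to both sides produces the subtraction-free Stirling
  -- recurrence on the left.
  S₁-coefficient (suc n) l = +-cancelʳ (N * (n! * y)) _ _ (begin
    fromℤ (S₁ (suc n) l) * ((l !) × 1#) + N * (n! * y)
      ≈⟨ +-congˡ (*-congˡ (S₁-coefficient n l)) ⟨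
    fromℤ (S₁ (suc n) l) * ((l !) × 1#) + N * (fromℤ (S₁ n l) * ((l !) × 1#))
      ≈⟨ solve 4 (λ a b c d → a :* b :+ c :* (d :* b) := (a :+ c :* d) :* b) refl _ _ _ _ ⟩
    (fromℤ (S₁ (suc n) l) + N * fromℤ (S₁ n l)) * ((l !) × 1#)
      ≈⟨ recurrence l ⟩
    n! * ((l × 1#) * x)
      ≈⟨ *-congˡ step ⟩
    n! * ((1# + N) * x′ + N * y)
      ≈⟨ solve 4 (λ a b c d → b :* ((con 1 :+ a) :* c :+ a :* d) := (con 1 :+ a) :* b :* c :+ a :* (b :* d)) refl N n! x′ y ⟩
    (1# + N) * n! * x′ + N * (n! * y)
      ≈⟨ +-congʳ (*-congʳ (suc-! n)) ⟨
    ((suc n !) × 1#) * x′ + N * (n! * y) ∎)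
    where
    open RawSemiringDefs (RawRing.rawSemiring S.rawRing) using () renaming (_×_ to _S×_)
    N n! x x′ y : Carrier
    N  = n × 1#
    n! = (n !) × 1#
    x  = (t ^ₛ l *ₛ h n) (suc n)
    x′ = (t ^ₛ l *ₛ h (suc n)) (suc n)
    y  = (t ^ₛ l *ₛ h n) n

    -- Reads `θ-t^*h` in degree n+1. There θ multiplies by n+1, the very factor of `t ^ₛ l *ₛ h n`
    -- on the other side; cancelling these leaves only the factor l that came from θ(t^l).
    step : (l × 1#) * x ≈ (1# + N) * x′ + N * y
    step = +-cancelʳ ((1# + N) * x) _ _ (begin
      (l × 1#) * x + (1# + N) * x
        ≈⟨ +-cong (×1ₛ-*ₛ l (t ^ₛ l *ₛ h n) (suc n)) (×1ₛ-*ₛ (suc n) (t ^ₛ l *ₛ h n) (suc n)) ⟨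
      (((l S× 1ₛ) *ₛ (t ^ₛ l *ₛ h n)) +ₛ ((suc n S× 1ₛ) *ₛ (t ^ₛ l *ₛ h n))) (suc n)
        ≈⟨ θ-t^*h l n (suc n) ⟨
      (1# + N) * x + ((suc n S× 1ₛ) *ₛ (t ^ₛ l *ₛ h (suc n))) (suc n) + ((n S× 1ₛ) *ₛ (t *ₛ (t ^ₛ l *ₛ h n))) (suc n)
        ≈⟨ +-cong (+-congˡ (×1ₛ-*ₛ (suc n) (t ^ₛ l *ₛ h (suc n)) (suc n)))
             (trans (×1ₛ-*ₛ n (t *ₛ (t ^ₛ l *ₛ h n)) (suc n)) (*-congˡ (t-*ₛ-suc (t ^ₛ l *ₛ h n) n))) ⟩
      (1# + N) * x + (1# + N) * x′ + N * y
        ≈⟨ solve 3 (λ a b c → a :+ b :+ c := b :+ c :+ a) refl _ _ _ ⟩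
      (1# + N) * x′ + N * y + (1# + N) * x ∎)

    -- The factor l is the one in l! = l (l-1)!, which joins the induction hypothesis at l-1. For l
    -- = 0 both sides vanish.
    recurrence : ∀ l → (fromℤ (S₁ (suc n) l) + N * fromℤ (S₁ n l)) * ((l !) × 1#)
                     ≈ n! * ((l × 1#) * (t ^ₛ l *ₛ h n) (suc n))
    recurrence zero    = begin
      (fromℤ (S₁ (suc n) 0) + N * fromℤ (S₁ n 0)) * ((0 !) × 1#)
        ≈⟨ trans (*-congʳ (fromℤ-recurrence n (S₁ (suc n) 0) (S₁ n 0) (S₁-suc-zero n))) (zeroˡ _) ⟩
      0#
        ≈⟨ trans (*-congˡ (zeroˡ _)) (zeroʳ _) ⟨
      n! * (0# * (t ^ₛ 0 *ₛ h n) (suc n)) ∎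
    recurrence (suc l) = begin
      (fromℤ (S₁ (suc n) (suc l)) + N * fromℤ (S₁ n (suc l))) * ((suc l !) × 1#)
        ≈⟨ *-cong (fromℤ-recurrence n (S₁ (suc n) (suc l)) (S₁ n (suc l)) (S₁-suc-suc n l)) (suc-! l) ⟩
      fromℤ (S₁ n l) * ((suc l × 1#) * ((l !) × 1#))
        ≈⟨ solve 3 (λ a b c → a :* (b :* c) := b :* (a :* c)) refl _ _ _ ⟩
      (suc l × 1#) * (fromℤ (S₁ n l) * ((l !) × 1#))
        ≈⟨ *-congˡ (S₁-coefficient n l) ⟩
      (suc l × 1#) * (n! * (t ^ₛ l *ₛ h n) n)
        ≈⟨ *-congˡ (*-congˡ (t^-suc-*ₛ l (h n) n)) ⟨
      (suc l × 1#) * (n! * (t ^ₛ suc l *ₛ h n) (suc n))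
        ≈⟨ solve 3 (λ a b c → a :* (b :* c) := b :* (a :* c)) refl _ _ _ ⟩
      n! * ((suc l × 1#) * (t ^ₛ suc l *ₛ h n) (suc n)) ∎

  -- The x^j-coefficients of the two sides.

  coeff-X+1 : coeff (X +ₚ 1ₚ) ≈ₛ t +ₛ 1ₛ
  coeff-X+1 = S.trans (coeff-+ₚ X 1ₚ) (S.+-cong coeff-X coeff-1ₚ)

  -- The powers of f are constant in x, so the substitution passes through the Cauchy sum to the
  -- powers of x, where `[t+1]^` applies; the resulting 1/j! is the same in every summand and
  -- factors out.
  coeff-B⟨X+1⟩ : ∀ r n j → coeff (B r n ⟨ X +ₚ 1ₚ ⟩) j
    ≈ ((n !) × 1#) * (1/ j ! * (t/[eᵗ-1] ^ₛ r *ₛ (t ^ₛ j *ₛ eᵗ)) n)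
  coeff-B⟨X+1⟩ r n j = begin
    ⟦ B r n ⟧ j
      ≈⟨ trans (⟦⟧-· _ (generatingFunction r n) j) (C-*ₛ _ ⟦ generatingFunction r n ⟧ j) ⟩
    ((n !) × 1#) * ⟦ generatingFunction r n ⟧ j
      ≈⟨ *-congˡ (⟦⟧-sumₚ (λ (k : Fin (suc n)) → C (fʳ (toℕ k)) *ₚ eˣᵗ (n ∸ toℕ k)) j) ⟩
    ((n !) × 1#) * sum (λ (k : Fin (suc n)) → ⟦ C (fʳ (toℕ k)) *ₚ eˣᵗ (n ∸ toℕ k) ⟧ j)
      ≈⟨ *-congˡ (sum-cong-≋ {suc n} (λ k → term (toℕ k) (n ∸ toℕ k))) ⟩
    ((n !) × 1#) * sum (λ (k : Fin (suc n)) → 1/ j ! * (fʳ (toℕ k) * (t ^ₛ j *ₛ eᵗ) (n ∸ toℕ k)))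
      ≈⟨ *-congˡ (*-distribˡ-sum (1/ j !) (λ (k : Fin (suc n)) → fʳ (toℕ k) * (t ^ₛ j *ₛ eᵗ) (n ∸ toℕ k))) ⟨
    ((n !) × 1#) * (1/ j ! * (fʳ *ₛ (t ^ₛ j *ₛ eᵗ)) n) ∎
    where
    open Composition (X +ₚ 1ₚ)
    fʳ : R[[t]].Series
    fʳ = t/[eᵗ-1] ^ₛ r
    term : ∀ k m → ⟦ C (fʳ k) *ₚ eˣᵗ m ⟧ j ≈ 1/ j ! * (fʳ k * (t ^ₛ j *ₛ eᵗ) m)
    term k m = begin
      ⟦ C (fʳ k) *ₚ eˣᵗ m ⟧ j
        ≈⟨ ⟦⟧-*ₚ (C (fʳ k)) (eˣᵗ m) j ⟩
      (⟦ C (fʳ k) ⟧ *ₛ ⟦ eˣᵗ m ⟧) j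
        ≈⟨ trans (*ₛ-congʳ ⟦ eˣᵗ m ⟧ (⟦⟧-C (fʳ k)) j) (C-*ₛ (fʳ k) ⟦ eˣᵗ m ⟧ j) ⟩
      fʳ k * ⟦ 1/ m ! · X ^ₚ m ⟧ j
        ≈⟨ *-congˡ (trans (⟦⟧-· (1/ m !) (X ^ₚ m) j) (C-*ₛ (1/ m !) ⟦ X ^ₚ m ⟧ j)) ⟩
      fʳ k * (1/ m ! * ⟦ X ^ₚ m ⟧ j)
        ≈⟨ *-congˡ (*-congˡ (trans (⟦⟧-X^ m j) (^ₛ-cong coeff-X+1 m j))) ⟩
      fʳ k * (1/ m ! * ((t +ₛ 1ₛ) ^ₛ m) j)
        ≈⟨ *-congˡ ([t+1]^ m j) ⟩
      fʳ k * (1/ j ! * (t ^ₛ j *ₛ eᵗ) m)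
        ≈⟨ solve 3 (λ a b c → a :* (b :* c) := b :* (a :* c)) refl _ _ _ ⟩
      1/ j ! * (fʳ k * (t ^ₛ j *ₛ eᵗ) m) ∎

  -- The sum over l is itself a Cauchy product in degree n: integrating u^l / l! over [x, x+1] gives
  -- the t^l-coefficient of t^j E / j!, and l! S₁(n,l) gives n! times the coefficient of `h n` in
  -- degree n-l.
  coeff-integral : ∀ n j → coeff (sumₚ (λ (l : Fin (suc n)) →
      (fromℤ (S₁ n (toℕ l)) * 1/suc (toℕ l)) · ((X +ₚ 1ₚ) ^ₚ suc (toℕ l) -ₚ X ^ₚ suc (toℕ l)))) j
    ≈ ((n !) × 1#) * (1/ j ! * ((t ^ₛ j *ₛ [eᵗ-1]/t) *ₛ h n) n)
  coeff-integral n j = begin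
    coeff (sumₚ (λ (l : Fin (suc n)) → summand (toℕ l))) j
      ≈⟨ coeff-sumₚ (λ (l : Fin (suc n)) → summand (toℕ l)) j ⟩
    sum (λ (l : Fin (suc n)) → coeff (summand (toℕ l)) j)
      ≈⟨ sum-cong-≋ {suc n} (λ l → term (toℕ l) (toℕ≤pred[n] l)) ⟩
    sum (λ (l : Fin (suc n)) → (n! * 1/ j !) * (g (toℕ l) * h n (n ∸ toℕ l)))
      ≈⟨ *-distribˡ-sum (n! * 1/ j !) (λ (l : Fin (suc n)) → g (toℕ l) * h n (n ∸ toℕ l)) ⟨
    (n! * 1/ j !) * (g *ₛ h n) n
      ≈⟨ *-assoc _ _ _ ⟩
    n! * (1/ j ! * (g *ₛ h n) n) ∎
    where
    n! : Carrier
    n! = (n !) × 1#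
    g : R[[t]].Series
    g = t ^ₛ j *ₛ [eᵗ-1]/t
    summand : ℕ → Poly
    summand l = (fromℤ (S₁ n l) * 1/suc l) · ((X +ₚ 1ₚ) ^ₚ suc l -ₚ X ^ₚ suc l)

    difference : ∀ l → coeff ((X +ₚ 1ₚ) ^ₚ suc l -ₚ X ^ₚ suc l) j
                     ≈ ((t +ₛ 1ₛ) ^ₛ suc l) j + - (t ^ₛ suc l) j
    difference l = trans (coeff-+ₚ ((X +ₚ 1ₚ) ^ₚ suc l) (-ₚ (X ^ₚ suc l)) j) (+-cong
      (trans (coeff-^ₚ (X +ₚ 1ₚ) (suc l) j) (^ₛ-cong coeff-X+1 (suc l) j))
      (trans (coeff--ₚ (X ^ₚ suc l) j) (-‿cong (trans (coeff-^ₚ X (suc l) j) (^ₛ-cong coeff-X (suc l) j)))))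

    term : ∀ l → l ≤ n → coeff (summand l) j ≈ (n! * 1/ j !) * (g l * h n (n ∸ l))
    term l l≤n = begin
      coeff (summand l) j
        ≈⟨ coeff-· (fromℤ (S₁ n l) * 1/suc l) ((X +ₚ 1ₚ) ^ₚ suc l -ₚ X ^ₚ suc l) j ⟩
      (s * 1/suc l) * coeff ((X +ₚ 1ₚ) ^ₚ suc l -ₚ X ^ₚ suc l) j
        ≈⟨ *-congˡ (difference l) ⟩
      (s * 1/suc l) * Δ
        -- Inserting l!/l! splits 1/(l+1) into l! for the Stirling number and 1/(l+1)! for the
        -- difference of powers.
        ≈⟨ trans (*-congʳ (1/!-inverse l)) (*-identityˡ _) ⟨
      (1/ l ! * ((l !) × 1#)) * ((s * 1/suc l) * Δ)
        ≈⟨ solve 5 (λ a b c d e → (a :* b) :* ((c :* d) :* e) := (c :* b) :* ((d :* a) :* e)) refl _ _ _ _ _ ⟩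
      (s * ((l !) × 1#)) * (1/ suc l ! * Δ)
        ≈⟨ *-cong (S₁-coefficient n l) ([t+1]^-t^ l j) ⟩
      (n! * (t ^ₛ l *ₛ h n) n) * (1/ j ! * g l)
        -- The summation range gives l ≤ n, so here truncated subtraction is the true one.
        ≈⟨ *-congʳ (*-congˡ (t^*ₛ-∸ (h n) l≤n)) ⟩
      (n! * h n (n ∸ l)) * (1/ j ! * g l)
        ≈⟨ solve 4 (λ a b c d → (a :* b) :* (c :* d) := (a :* c) :* (d :* b)) refl _ _ _ _ ⟩
      (n! * 1/ j !) * (g l * h n (n ∸ l)) ∎
      where
      s Δ : Carrier
      s = fromℤ (S₁ n l)
      Δ = ((t +ₛ 1ₛ) ^ₛ suc l) j + - (t ^ₛ suc l) j

  fⁿt^e≈t^Eh : ∀ n j → t/[eᵗ-1] ^ₛ n *ₛ (t ^ₛ j *ₛ eᵗ) ≈ₛ (t ^ₛ j *ₛ [eᵗ-1]/t) *ₛ h n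
  fⁿt^e≈t^Eh n j = S.trans
    (Series.solve 3 (λ x y z → x Series.:* (y Series.:* z) Series.:= y Series.:* (x Series.:* z))
      S.refl (t/[eᵗ-1] ^ₛ n) (t ^ₛ j) eᵗ)
    (S.trans (*ₛ-congˡ (t ^ₛ j) (S.sym (hE≈fⁿe n)))
      (Series.solve 3 (λ x y z → y Series.:* (x Series.:* z) Series.:= (y Series.:* z) Series.:* x)
        S.refl (h n) (t ^ₛ j) [eᵗ-1]/t))
    where module Series = RingSolver S.commutativeSemiring

theorem3 : ∀ {c ℓ} (R : CommutativeRing c ℓ) (isℚAlgebra : IsℚAlgebra R) →
    let open CommutativeRing R using (_*_)
        open Bernoulli R isℚAlgebra
        open R[x]
    in
    ∀ (n : ℕ) → 1 ≤ n →
    B n n ⟨ X +ₚ 1ₚ ⟩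
      ≈ₚ sumₚ (λ (l : Fin (suc n)) →
           (fromℤ (S₁ n (toℕ l)) * 1/suc (toℕ l))
             · ((X +ₚ 1ₚ) ^ₚ suc (toℕ l) -ₚ X ^ₚ suc (toℕ l)))
theorem3 R isℚAlgebra n _ j =
  trans (coeff-B⟨X+1⟩ R isℚAlgebra n n j)
    (trans (*-congˡ (*-congˡ (fⁿt^e≈t^Eh R isℚAlgebra n j n)))
      (sym (coeff-integral R isℚAlgebra n j)))
  where open CommutativeRing R
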